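{- Let $n,k\ge1$ and fix subsets $D_1,\ldots,D_k\subseteq[n-1]$. For integers $0\le i_1\le i_2\le i_3\le k$ and a permutation $\pi$ of $[k]$, let $C(i_1,i_2,i_3;\pi)$ be the number of $(\sigma_1,\ldots,\sigma_k)\in W^{(k)}$ such that, for every $i\in[k]$, $$D_i=\begin{cases}\mathrm{Des}(\sigma_{\pi(i)})&\text{if }0<i\le i_1,\\ \mathrm{Codes}(\sigma_{\pi(i)})&\text{if }i_1<i\le i_2,\\ \mathrm{Asc}(\sigma_{\pi(i)})&\text{if }i_2<i\le i_3,\\ \mathrm{Coasc}(\sigma_{\pi(i)})&\text{if }i_3<i\le k.\end{cases}$$ Then $C(i_1,i_2,i_3;\pi)$ depends only on the parity of $i_2$; in particular it does not depend on $i_1$, $i_3$ or $\pi$.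
   Context: $W=S_n$, and $W^{(k)}=\{(\sigma_1,\ldots,\sigma_k)\in W^k:\sigma_1\cdots\sigma_k=1\}$. For $\sigma\in W$: - $\mathrm{Des}(\sigma)=\{i\in[n-1]:\sigma(i)>\sigma(i+1)\}$; - $\mathrm{Codes}(\sigma)=\{i:n-i\in\mathrm{Des}(\sigma)\}$; - $\mathrm{Asc}(\sigma)=[n-1]\setminus\mathrm{Des}(\sigma)$; - $\mathrm{Coasc}(\sigma)=\{i:n-i\in\mathrm{Asc}(\sigma)\}$. -}

module Defs where

open import Data.Nat using (ℕ; zero; suc; _<ᵇ_)
open import Data.Bool using (Bool; true; false; _∧_; _∨_; not)
import Data.Bool as Bool
open import Data.List using (List; []; _∷_; [_]; map; concatMap; length; filterᵇ)
open import Data.Bool.ListAction using (and)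
import Data.List as List
open import Data.Fin using (Fin; zero; suc; toℕ; inject₁; opposite)
open import Data.Fin.Properties using (_≟_; _<?_)
open import Data.Fin.Subset using (Subset; ∁)
open import Data.Fin.Permutation using (Permutation′; _⟨$⟩ʳ_)
open import Data.Vec using (Vec; []; _∷_; lookup; tabulate; foldr)
import Data.Vec as Vec
open import Data.Vec.Properties using (≡-dec)
open import Relation.Nullary.Decidable using (⌊_⌋)

-- Elements of S_n are represented by their one-line notation:
-- a vector σ of length n with σ(i) = lookup σ i (0-indexed), required injective.

allᵇ : {A : Set} → (A → Bool) → List A → Bool
allᵇ p xs = and (map p xs)

vecsOver : {A : Set} → List A → (k : ℕ) → List (Vec A k)
vecsOver xs zero = [ [] ]
vecsOver xs (suc k) = concatMap (λ x → map (x ∷_) (vecsOver xs k)) xs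

injectiveᵇ : {n m : ℕ} → Vec (Fin n) m → Bool
injectiveᵇ {n} {m} v =
  allᵇ (λ a → allᵇ (λ b → not ⌊ lookup v a ≟ lookup v b ⌋ ∨ ⌊ a ≟ b ⌋) (List.allFin m)) (List.allFin m)

Sym : (n : ℕ) → List (Vec (Fin n) n)
Sym n = filterᵇ injectiveᵇ (vecsOver (List.allFin n) n)

_∘ₚ_ : {n : ℕ} → Vec (Fin n) n → Vec (Fin n) n → Vec (Fin n) n
σ ∘ₚ τ = Vec.map (lookup σ) τ

idₚ : {n : ℕ} → Vec (Fin n) n
idₚ {n} = Vec.allFin n

prodₚ : {n k : ℕ} → Vec (Vec (Fin n) n) k → Vec (Fin n) n
prodₚ = foldr _ _∘ₚ_ idₚ

-- Throughout n = suc m; a subset of [n-1] = {1,…,m} is a Subset m,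
-- index j : Fin m standing for the integer j+1.
-- Des σ : i ∈ Des σ iff σ(i) > σ(i+1)  (1-indexed positions i, i+1)
Des : {m : ℕ} → Vec (Fin (suc m)) (suc m) → Subset m
Des σ = tabulate (λ j → ⌊ lookup σ (suc j) <? lookup σ (inject₁ j) ⌋)

-- Codes σ = { i : n - i ∈ Des σ }; integer j+1 ↦ n-(j+1) = m-j, i.e. index opposite j
Codes : {m : ℕ} → Vec (Fin (suc m)) (suc m) → Subset m
Codes σ = tabulate (λ j → lookup (Des σ) (opposite j))

Asc : {m : ℕ} → Vec (Fin (suc m)) (suc m) → Subset m
Asc σ = ∁ (Des σ)

Coasc : {m : ℕ} → Vec (Fin (suc m)) (suc m) → Subset m
Coasc σ = tabulate (λ j → lookup (Asc σ) (opposite j))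

-- the statistic applied at position i ∈ [k] (i = toℕ i' + 1 for i' : Fin k)
stat : {m k : ℕ} → ℕ → ℕ → ℕ → Fin k → Vec (Fin (suc m)) (suc m) → Subset m
stat i₁ i₂ i₃ i σ =
  if (toℕ i <ᵇ i₁) then Des σ else
  if (toℕ i <ᵇ i₂) then Codes σ else
  if (toℕ i <ᵇ i₃) then Asc σ else Coasc σ
  where open Data.Bool using (if_then_else_)

condᵇ : {m k : ℕ} → (Fin k → Subset m) → ℕ → ℕ → ℕ → Permutation′ k →
        Vec (Vec (Fin (suc m)) (suc m)) k → Bool
condᵇ {m} {k} D i₁ i₂ i₃ π σs =
  ⌊ ≡-dec _≟_ (prodₚ σs) idₚ ⌋ ∧
  allᵇ (λ i → ⌊ ≡-dec Bool._≟_ (D i) (stat i₁ i₂ i₃ i (lookup σs (π ⟨$⟩ʳ i))) ⌋) (List.allFin k)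

C : {m k : ℕ} → (Fin k → Subset m) → ℕ → ℕ → ℕ → Permutation′ k → ℕ
C {m} {k} D i₁ i₂ i₃ π = length (filterᵇ (condᵇ D i₁ i₂ i₃ π) (vecsOver (Sym (suc m)) k))

{-# OPTIONS --safe #-}
-- Read σ₁ ⋯ σ_k = 1 as a radix sort of n objects: σ_j carries positions after pass j to positions
-- before it, so object p sits at position σ_{j+1} ⋯ σ_k (p) after pass j.  Fix sets I_j and replace
-- each condition "statistic = D_j" by "statistic ⊆ I_j".  Then pass j sorts by a key whose
-- distribution is given by I_j, in the reversed key order for Codes and Coasc, and it breaks ties by
-- the previous order, which is reversed for Asc and Coasc.  As the product is 1, the objects start
-- out sorted by the resulting signed lexicographic order on k-tuples of keys.  Hence the number of
-- factorizations is the number of multisets of n key tuples with the prescribed marginals if the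
-- number k − i₂ of tie reversals is even, and the number of such sets without repetition if it is
-- odd.  Neither depends on the order of the passes or on the direction of the keys.  Möbius
-- inversion over the I_j recovers the counts for "statistic = D_j".
module Submission where

open import Defs
open import Algebra using (CommutativeRing)
open import Data.Bool using (Bool; true; false; _∧_; _∨_; _xor_; not; T; if_then_else_)
import Data.Bool.Properties as Boolₚ
open Boolₚ using (T-≡; T-not-≡; T-∧)
open import Data.Empty using (⊥-elim)
open import Data.Fin as Fin using (Fin; zero; suc; toℕ; fromℕ<; punchOut; opposite; inject₁; combine; remQuot; _<_)
open import Data.Fin.Permutation as Permutation using (Permutation′; _⟨$⟩ʳ_; _⟨$⟩ˡ_; inverseˡ; inverseʳ)
import Data.Fin.Properties as Fin
open import Data.Fin.Subset using (Subset; ∣_∣; _∈_)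
import Data.Fin.Subset.Properties as Sub
open import Data.List as List using (List; []; _∷_; [_]; _++_; length; filterᵇ; concatMap; map; cartesianProductWith)
open import Data.List.Membership.Propositional using () renaming (_∈_ to _∈ₗ_)
import Data.List.Membership.Propositional.Properties as ∈ₗ
open import Data.List.Properties using (length-++)
import Data.List.Relation.Unary.All as All
import Data.List.Relation.Unary.All.Properties as All
open import Data.List.Relation.Unary.AllPairs using ([]; _∷_)
open import Data.List.Relation.Unary.Any using (here; there)
open import Data.List.Relation.Unary.Unique.Propositional using (Unique)
import Data.List.Relation.Unary.Unique.Propositional.Properties as Unique
open import Data.Nat as ℕ using (ℕ; zero; suc; _≤_; _%_; _<ᵇ_; z≤n; s≤s)
import Data.Nat.Properties as ℕ
open import Data.Product using (∃; ∃₂; _×_; _,_; proj₁; proj₂; uncurry; map₁; map₂)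
open import Data.Sum as Sum using (_⊎_; inj₁; inj₂)
open import Data.Unit using (⊤; tt)
open import Data.Vec using (Vec; []; _∷_; lookup; tabulate)
open import Data.Vec.Properties using (lookup∘tabulate; tabulate∘lookup; tabulate-cong; lookup-map; []=⇒lookup; lookup⇒[]=; lookup-allFin; ∷-injective; ≡-dec)
open import Function using (_∘_; flip; id)
open import Function.Bundles using (Equivalence)
open import Function.Definitions using (Injective)
open import Level using (0ℓ)
open import Relation.Binary using (Rel; Reflexive; Transitive; Decidable; tri<; tri≈; tri>)
open import Relation.Binary.PropositionalEquality using (_≡_; _≢_; _≗_; refl; sym; trans; cong; cong₂; subst; subst₂; module ≡-Reasoning)
open import Relation.Nullary using (¬_; ¬?; yes; no; contradiction)
open import Relation.Nullary.Decidable using (⌊_⌋; T?; toWitness; fromWitness; toWitnessFalse; fromWitnessFalse; _×-dec_; _⊎-dec_)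
open import Algebra.Properties.CommutativeMonoid.Sum (CommutativeRing.+-commutativeMonoid Boolₚ.xor-∧-commutativeRing) using () renaming (sum to xorSum; sum-permute to xorSum-permute)

open Equivalence using (to; from)

-- Injective self-maps of Fin n

Inj : ∀ {m n} → (Fin m → Fin n) → Set
Inj f = Injective _≡_ _≡_ f

-- Pigeonhole: a missed value `y` could be punched out of the range, leaving an injection of
-- `Fin (suc n)` into `Fin n`.
injective⇒surjective : ∀ {n} {f : Fin n → Fin n} → Inj f → ∀ y → ∃ λ x → f x ≡ y
injective⇒surjective {suc n} {f} f-inj y with Fin.any? (λ x → f x Fin.≟ y)
... | yes found = found
... | no none = contradiction (Fin.injective⇒≤ punched-inj) ℕ.1+n≰n
  where
  y≢f : ∀ x → y ≢ f x
  y≢f x eq = none (x , sym eq)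
  punched-inj : Inj (λ x → punchOut (y≢f x))
  punched-inj {a} {b} eq = f-inj (Fin.punchOut-injective (y≢f a) (y≢f b) eq)

module Inverse {n} {f : Fin n → Fin n} (f-inj : Inj f) where

  f⁻¹ : Fin n → Fin n
  f⁻¹ y = proj₁ (injective⇒surjective f-inj y)

  f∘f⁻¹ : ∀ y → f (f⁻¹ y) ≡ y
  f∘f⁻¹ y = proj₂ (injective⇒surjective f-inj y)

  f⁻¹∘f : ∀ x → f⁻¹ (f x) ≡ x
  f⁻¹∘f x = f-inj (f∘f⁻¹ (f x))

  f⁻¹-inj : Inj f⁻¹
  f⁻¹-inj {a} {b} eq = trans (sym (f∘f⁻¹ a)) (trans (cong f eq) (f∘f⁻¹ b))

-- An injection f has j ≤ p with p ≤ f j, and j ≥ p with f j ≤ p.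
rearrangement-agrees : ∀ {n} {f : Fin n → Fin n} {_≼_ : Rel (Fin n) 0ℓ} →
  Inj f → Reflexive _≼_ → Transitive _≼_ →
  (∀ {p q} → p < q → p ≼ q) → (∀ {p q} → p < q → f p ≼ f q) →
  ∀ p → p ≼ f p × f p ≼ p
rearrangement-agrees {f = f} {_≼_} f-inj ≼-refl ≼-trans id-mono f-mono p = lower , upper
  where
  open Inverse f-inj
  weaken : ∀ (h : Fin _ → Fin _) → (∀ {p q} → p < q → h p ≼ h q) → ∀ {p q} → p Fin.≤ q → h p ≼ h q
  weaken h mono {p} {q} p≤q with p Fin.≟ q
  ... | yes refl = ≼-refl
  ... | no  p≢q  = mono (Fin.≤∧≢⇒< p≤q p≢q)
  lower : p ≼ f p
  lower with j , j≤p , p≤fj ← Fin.injective⇒existsPivot f-inj p =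
    ≼-trans (weaken id id-mono p≤fj) (weaken f f-mono j≤p)
  upper : f p ≼ p
  -- The pivot now belongs to the inverse: `f p ≼ f (f⁻¹ j)`, where `f (f⁻¹ j)` is `j`, and `j ≼ p`.
  upper with j , j≤p , p≤f⁻¹j ← Fin.injective⇒existsPivot f⁻¹-inj p =
    ≼-trans (weaken f f-mono p≤f⁻¹j)
      (subst (_≼ p) (sym (f∘f⁻¹ j)) (weaken id id-mono j≤p))

-- The composite `g ∘ f⁻¹` is an increasing self-injection of `Fin n`, and only the identity is one.
same-order⇒≗ : ∀ {n} {f g : Fin n → Fin n} → Inj f → Inj g →
  (∀ {p q} → f p < f q → g p < g q) → f ≗ g
same-order⇒≗ {f = f} {g} f-inj g-inj mono p =
  trans (Fin.≤-antisym (proj₁ agree) (proj₂ agree)) (cong g (f⁻¹∘f p))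
  where
  open Inverse f-inj
  agree : f p Fin.≤ g (f⁻¹ (f p)) × g (f⁻¹ (f p)) Fin.≤ f p
  agree = rearrangement-agrees {f = g ∘ f⁻¹} {_≼_ = Fin._≤_} (f⁻¹-inj ∘ g-inj) ℕ.≤-refl ℕ.≤-trans
    ℕ.<⇒≤ (λ {a} {b} a<b → ℕ.<⇒≤ (mono (subst₂ _<_ (sym (f∘f⁻¹ a)) (sym (f∘f⁻¹ b)) a<b))) (f p)

-- Ranks in a finite strict total order

module Rank {n} {R : Rel (Fin n) 0ℓ} (R? : Decidable R) (R-trans : Transitive R)
            (R-irrefl : ∀ {p} → ¬ R p p) (R-total : ∀ {p q} → p ≢ q → R p q ⊎ R q p) where

  below : Fin n → Subset n
  below p = tabulate (λ q → ⌊ R? q p ⌋)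

  ∈-below⁺ : ∀ {p q} → R q p → q ∈ below p
  ∈-below⁺ {p} {q} r = lookup⇒[]= q (below p)
    (trans (lookup∘tabulate _ q) (to T-≡ (fromWitness r)))

  ∈-below⁻ : ∀ {p q} → q ∈ below p → R q p
  ∈-below⁻ {p} {q} q∈ = toWitness
    (from T-≡ (trans (sym (lookup∘tabulate _ q)) ([]=⇒lookup q∈)))

  rank<n : ∀ p → ∣ below p ∣ ℕ.< n
  rank<n p = subst (∣ below p ∣ ℕ.<_) (Sub.∣⊤∣≡n n)
    (Sub.p⊂q⇒∣p∣<∣q∣ (Sub.⊆⊤ , p , Sub.∈⊤ , R-irrefl ∘ ∈-below⁻))

  rank : Fin n → Fin n
  rank p = fromℕ< (rank<n p)

  rank-mono : ∀ {p q} → R p q → rank p < rank q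
  rank-mono {p} {q} r = subst₂ ℕ._<_ (sym (Fin.toℕ-fromℕ< (rank<n p))) (sym (Fin.toℕ-fromℕ< (rank<n q)))
    (Sub.p⊂q⇒∣p∣<∣q∣ ((λ x∈ → ∈-below⁺ (R-trans (∈-below⁻ x∈) r)) , p , ∈-below⁺ r , R-irrefl ∘ ∈-below⁻))

  rank-inj : Inj rank
  rank-inj {p} {q} eq with p Fin.≟ q
  ... | yes p≡q = p≡q
  ... | no p≢q with R-total p≢q
  ... | inj₁ r = contradiction (rank-mono r) (Fin.<-irrefl eq)
  ... | inj₂ r = contradiction (rank-mono r) (Fin.<-irrefl (sym eq))

  rank-cancel : ∀ {p q} → rank p < rank q → R p q
  rank-cancel {p} {q} lt with p Fin.≟ q
  ... | yes refl = contradiction lt (Fin.<-irrefl refl)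
  ... | no p≢q with R-total p≢q
  ... | inj₁ r = r
  ... | inj₂ r = contradiction (rank-mono r) (Fin.<-asym lt)

-- Signed lexicographic orders

orient : {A : Set} → Bool → Rel A 0ℓ → Rel A 0ℓ
orient false R x y = R x y
orient true  R x y = R y x

orient-trans : ∀ {A : Set} b {R : Rel A 0ℓ} → Transitive R → Transitive (orient b R)
orient-trans false t = t
orient-trans true  t = flip t

orient-xor : ∀ {A : Set} a b {R : Rel A 0ℓ} {x y} → orient b (orient a R) x y → orient (a xor b) R x y
orient-xor false b     r = r
orient-xor true  false r = r
orient-xor true  true  r = r

orient-map : ∀ {A B : Set} b {R : Rel A 0ℓ} {S : Rel B 0ℓ} {x y x′ y′} →
  (R x y → S x′ y′) → (R y x → S y′ x′) → orient b R x y → orient b S x′ y′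
orient-map false f g = f
orient-map true  f g = g

orient-dec : ∀ {A : Set} b {R : Rel A 0ℓ} → Decidable R → Decidable (orient b R)
orient-dec false R? = R?
orient-dec true  R? = flip R?

orient-total : ∀ {A : Set} b {R : Rel A 0ℓ} {x y} → R x y ⊎ R y x → orient b R x y ⊎ orient b R y x
orient-total false r = r
orient-total true  (inj₁ r) = inj₂ r
orient-total true  (inj₂ r) = inj₁ r

orient-irrefl : ∀ {A : Set} b {R : Rel A 0ℓ} {x} → ¬ R x x → ¬ orient b R x x
orient-irrefl false ¬r = ¬r
orient-irrefl true  ¬r = ¬r

orient-reflexive : ∀ {A : Set} b {R : Rel A 0ℓ} {x y} → (∀ {x y} → x ≡ y → R x y) → x ≡ y → orient b R x y
orient-reflexive false r eq = r eq
orient-reflexive true  r eq = r (sym eq)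

orient-asym : ∀ {A : Set} b {R : Rel A 0ℓ} {x y} {E : Set} →
  (R x y → R y x → E) → orient b R x y → orient b R y x → E
orient-asym false f = f
orient-asym true  f = flip f

-- The order after one pass of a sort: `s` is the direction of the key, and `e` tells whether the
-- pass reverses the previous order `R` among objects with equal keys.
step : {A : Set} → Bool → Bool → (A → ℕ) → Rel A 0ℓ → Rel A 0ℓ
step s e w R p q = orient s ℕ._<_ (w p) (w q) ⊎ (w p ≡ w q × orient e R p q)

module _ {A : Set} (s e : Bool) (w : A → ℕ) {R : Rel A 0ℓ} where

  step-trans : Transitive R → Transitive (step s e w R)
  step-trans t (inj₁ l) (inj₁ l′) = inj₁ (orient-trans s ℕ.<-trans l l′)
  step-trans t {i} (inj₁ l) (inj₂ (eq , _)) = inj₁ (subst (orient s ℕ._<_ (w i)) eq l)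
  step-trans t {k = k} (inj₂ (eq , _)) (inj₁ l) = inj₁ (subst (λ x → orient s ℕ._<_ x (w k)) (sym eq) l)
  step-trans t (inj₂ (eq , r)) (inj₂ (eq′ , r′)) = inj₂ (trans eq eq′ , orient-trans e t r r′)

  step-dec : Decidable R → Decidable (step s e w R)
  step-dec R? p q = orient-dec s ℕ._<?_ (w p) (w q) ⊎-dec (w p ℕ.≟ w q ×-dec orient-dec e R? p q)

  -- Keeping `E` arbitrary covers both strict orders, with `E` empty, and preorders that compare
  -- keys alone, with `E` trivial.
  step-antisym : ∀ {p q} {E : Set} → (R p q → R q p → E) →
    step s e w R p q → step s e w R q p → w p ≡ w q × E
  step-antisym as (inj₁ l) (inj₁ l′) = ⊥-elim (orient-asym s ℕ.<-asym l l′)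
  step-antisym as (inj₁ l) (inj₂ (eq , _)) =
    ⊥-elim (orient-irrefl s (ℕ.<-irrefl refl) (subst (orient s ℕ._<_ _) eq l))
  step-antisym as (inj₂ (eq , _)) (inj₁ l) =
    ⊥-elim (orient-irrefl s (ℕ.<-irrefl refl) (subst (orient s ℕ._<_ _) eq l))
  step-antisym as (inj₂ (eq , r)) (inj₂ (_ , r′)) = eq , orient-asym e as r r′

  step-total : ∀ {p q} → R p q ⊎ R q p → step s e w R p q ⊎ step s e w R q p
  step-total {p} {q} r with ℕ.<-cmp (w p) (w q)
  ... | tri< l _ _ = Sum.map inj₁ inj₁ (orient-total s (inj₁ l))
  ... | tri> _ _ l = Sum.map inj₁ inj₁ (orient-total s (inj₂ l))
  ... | tri≈ _ eq _ = Sum.map (λ x → inj₂ (eq , x)) (λ x → inj₂ (sym eq , x)) (orient-total e r)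

  step-eq : ∀ {p q} → w p ≡ w q → step s e w R p q → orient e R p q
  step-eq eq (inj₁ l) = ⊥-elim (orient-irrefl s (ℕ.<-irrefl refl) (subst (orient s ℕ._<_ _) (sym eq) l))
  step-eq eq (inj₂ (_ , r)) = r

  step⇒≤ : ∀ {p q} → step s e w R p q → orient s _≤_ (w p) (w q)
  step⇒≤ (inj₁ l) = orient-map s ℕ.<⇒≤ ℕ.<⇒≤ l
  step⇒≤ (inj₂ (eq , _)) = orient-reflexive s ℕ.≤-reflexive eq

step-map : ∀ {A B : Set} (s e : Bool) {w : A → ℕ} {w′ : B → ℕ} {R : Rel A 0ℓ} {R′ : Rel B 0ℓ} {p q p′ q′} →
  w p ≡ w′ p′ → w q ≡ w′ q′ → (R p q → R′ p′ q′) → (R q p → R′ q′ p′) →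
  step s e w R p q → step s e w′ R′ p′ q′
step-map s e wp wq f g (inj₁ l) = inj₁ (subst₂ (orient s ℕ._<_) wp wq l)
step-map s e wp wq f g (inj₂ (eq , r)) = inj₂ (trans (sym wp) (trans eq wq) , orient-map e f g r)

-- Index zero is the first pass, hence the least significant key.
lex : ∀ {A : Set} {k} → (s e : Fin k → Bool) → (Fin k → A → ℕ) → Rel A 0ℓ → Rel A 0ℓ
lex {k = zero}  s e w R = R
lex {k = suc k} s e w R = lex (s ∘ suc) (e ∘ suc) (w ∘ suc) (step (s zero) (e zero) (w zero) R)

-- A reversal of ties exchanges the two arguments, hence the hypotheses on the base relations in
-- both directions.
lex-map : ∀ {A B : Set} {k} (s e : Fin k → Bool) {w : Fin k → A → ℕ} {w′ : Fin k → B → ℕ}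
  {R : Rel A 0ℓ} {R′ : Rel B 0ℓ} {p q p′ q′} →
  (∀ j → w j p ≡ w′ j p′) → (∀ j → w j q ≡ w′ j q′) → (R p q → R′ p′ q′) → (R q p → R′ q′ p′) →
  lex s e w R p q → lex s e w′ R′ p′ q′
lex-map {k = zero}  s e wp wq f g = f
lex-map {k = suc k} s e wp wq f g = lex-map (s ∘ suc) (e ∘ suc) (wp ∘ suc) (wq ∘ suc)
  (step-map (s zero) (e zero) (wp zero) (wq zero) f g)
  (step-map (s zero) (e zero) (wq zero) (wp zero) g f)

module _ {A : Set} where

  lex-trans : ∀ {k} (s e : Fin k → Bool) (w : Fin k → A → ℕ) {R : Rel A 0ℓ} →
    Transitive R → Transitive (lex s e w R)
  lex-trans {zero}  s e w t = t
  lex-trans {suc k} s e w t = lex-trans (s ∘ suc) (e ∘ suc) (w ∘ suc) (step-trans (s zero) (e zero) (w zero) t)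

  lex-antisym : ∀ {k} (s e : Fin k → Bool) (w : Fin k → A → ℕ) {R : Rel A 0ℓ} {p q} {E : Set} →
    (R p q → R q p → E) → lex s e w R p q → lex s e w R q p → (∀ j → w j p ≡ w j q) × E
  lex-antisym {zero}  s e w as r r′ = (λ ()) , as r r′
  lex-antisym {suc k} s e w as r r′
    with tail-eq , head-eq , x ← lex-antisym (s ∘ suc) (e ∘ suc) (w ∘ suc)
           (step-antisym (s zero) (e zero) (w zero) as) r r′
    = (λ { zero → head-eq ; (suc j) → tail-eq j }) , x

  lex-refl : ∀ {k} (s e : Fin k → Bool) (w : Fin k → A → ℕ) {R : Rel A 0ℓ} →
    Reflexive R → Reflexive (lex s e w R)
  lex-refl {zero}  s e w r = r
  lex-refl {suc k} s e w {R} r = lex-refl (s ∘ suc) (e ∘ suc) (w ∘ suc) (λ {x} → inj₂ (refl , tie (e zero)))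
    where
    tie : ∀ b {x} → orient b R x x
    tie false = r
    tie true  = r

  -- When all keys tie, every pass falls through to its tie rule; the base order is reversed once
  -- for each `true` in `e`, and the XOR is the net effect.
  lex-equal-keys : ∀ {k} (s e : Fin k → Bool) (w : Fin k → A → ℕ) {R : Rel A 0ℓ} {p q} →
    (∀ j → w j p ≡ w j q) → lex s e w R p q → orient (xorSum e) R p q
  lex-equal-keys {zero}  s e w eq r = r
  lex-equal-keys {suc k} s e w eq r = orient-xor (e zero) (xorSum (e ∘ suc))
    (orient-map (xorSum (e ∘ suc)) (step-eq (s zero) (e zero) (w zero) (eq zero))
      (step-eq (s zero) (e zero) (w zero) (sym (eq zero)))
      (lex-equal-keys (s ∘ suc) (e ∘ suc) (w ∘ suc) (eq ∘ suc) r))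

  -- The base order is consulted only after all keys have tied, so one differing key allows it to be
  -- exchanged for any other.
  lex-distinct-keys : ∀ {k} (s e : Fin k → Bool) (w : Fin k → A → ℕ) {R R′ : Rel A 0ℓ} {p q} j →
    w j p ≢ w j q → lex s e w R p q → lex s e w R′ p q
  lex-distinct-keys s e w {R} {R′} zero neq =
    lex-map (s ∘ suc) (e ∘ suc) (λ _ → refl) (λ _ → refl) (first neq) (first (neq ∘ sym))
    where
    first : ∀ {p q} → w zero p ≢ w zero q → step (s zero) (e zero) (w zero) R p q → step (s zero) (e zero) (w zero) R′ p q
    first neq (inj₁ l) = inj₁ l
    first neq (inj₂ (eq , _)) = contradiction eq neq
  lex-distinct-keys s e w (suc j) neq = lex-distinct-keys (s ∘ suc) (e ∘ suc) (w ∘ suc) j neq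

-- Block labels and descents

-- Index j of I stands for the cut between positions inject₁ j and suc j.
label : ∀ {m} → Subset m → Fin (suc m) → ℕ
label I       zero    = 0
label (b ∷ I) (suc a) = (if b then 1 else 0) ℕ.+ label I a

label-mono : ∀ {m} (I : Subset m) {a b} → a Fin.≤ b → label I a ≤ label I b
label-mono I       {zero}          _         = z≤n
label-mono (c ∷ I) {suc a} {suc b} (s≤s a≤b) = ℕ.+-monoʳ-≤ (if c then 1 else 0) (label-mono I a≤b)

label-adjacent : ∀ {m} (I : Subset m) j → lookup I j ≡ false → label I (inject₁ j) ≡ label I (suc j)
label-adjacent (false ∷ I) zero    eq = refl
label-adjacent (b ∷ I)     (suc j) eq = cong ((if b then 1 else 0) ℕ.+_) (label-adjacent I j eq)

-- Equal labels mean that no cut lies in between, so the comparisons of neighbours chain by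
-- transitivity.
blocks-monotone : ∀ {m} {X : Set} {R : Rel X 0ℓ} → Transitive R → (I : Subset m) (τ : Fin (suc m) → X) →
  (∀ j → lookup I j ≡ false → R (τ (inject₁ j)) (τ (suc j))) →
  ∀ {a b} → a < b → label I a ≡ label I b → R (τ a) (τ b)
blocks-monotone {R = R} t (c ∷ I) τ adj {suc a} {suc b} (s≤s a<b) eq =
  blocks-monotone {R = R} t I (τ ∘ suc) (adj ∘ suc) a<b (ℕ.+-cancelˡ-≡ (if c then 1 else 0) _ _ eq)
-- A cut at the head would give position `zero` the label 0 and every later one a positive label, so
-- only the head `false` remains.
blocks-monotone t (false ∷ I) τ adj {zero} {suc zero} a<b eq = adj zero refl
blocks-monotone {R = R} t (false ∷ I) τ adj {zero} {suc (suc b)} a<b eq =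
  t (adj zero refl) (blocks-monotone {R = R} t I (τ ∘ suc) (adj ∘ suc) {zero} {suc b} (s≤s z≤n) eq)

mirror : ∀ {n} → Bool → Fin n → Fin n
mirror false a = a
mirror true  a = opposite a

mirror-involutive : ∀ {n} s (a : Fin n) → mirror s (mirror s a) ≡ a
mirror-involutive false a = refl
mirror-involutive true  a = Fin.opposite-involutive a

mirror-inj : ∀ {n} s → Inj (mirror {n} s)
mirror-inj s {a} {b} eq = trans (sym (mirror-involutive s a)) (trans (cong (mirror s) eq) (mirror-involutive s b))

mirror-< : ∀ {n} s {a b : Fin n} → a < b → orient s _<_ (mirror s a) (mirror s b)
mirror-< false a<b = a<b
mirror-< true {a} {b} a<b = subst₂ ℕ._<_ (sym (Fin.opposite-prop b)) (sym (Fin.opposite-prop a))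
  (ℕ.∸-monoʳ-< (s≤s a<b) (Fin.toℕ<n b))

opposite-inject₁ : ∀ {n} (j : Fin n) → opposite (inject₁ j) ≡ suc (opposite j)
opposite-inject₁ zero    = refl
opposite-inject₁ (suc j) = cong inject₁ (opposite-inject₁ j)

-- For `s = true` the reflection makes labels weakly decrease along the positions while each label
-- keeps its multiplicity: a reversed key with the same distribution.
slabel : ∀ {m} → Bool → Subset m → Fin (suc m) → ℕ
slabel s I a = label I (mirror s a)

slabel-mono : ∀ {m} s (I : Subset m) {a b} → a < b → orient s _≤_ (slabel s I a) (slabel s I b)
slabel-mono s I a<b = orient-map s (label-mono I ∘ ℕ.<⇒≤) (label-mono I ∘ ℕ.<⇒≤) (mirror-< s a<b)

≤⇒<⊎≡ : ∀ s {x y} → orient s _≤_ x y → orient s ℕ._<_ x y ⊎ x ≡ y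
≤⇒<⊎≡ false le = ℕ.m≤n⇒m<n∨m≡n le
≤⇒<⊎≡ true  le = Sum.map id sym (ℕ.m≤n⇒m<n∨m≡n le)

-- Signed descent sets and monotonicity on blocks

Perm : ℕ → Set
Perm n = Vec (Fin n) n

signedDes : ∀ {m} → Bool → Bool → Perm (suc m) → Subset m
signedDes false false = Des
signedDes true  false = Codes
signedDes false true  = Asc
signedDes true  true  = Coasc

-- Inclusion in contrapositive form, because absence from a statistic is what compares two
-- neighbouring values in the direction required.
_⊑_ : ∀ {m} → Subset m → Subset m → Set
S ⊑ I = ∀ j → lookup I j ≡ false → lookup S j ≡ false

-- Values of `σ` are positions before a pass, so this describes the treatment of ties: the previous
-- order is kept or reversed inside each block.
BlockMonotone : ∀ {m} → Bool → Bool → Subset m → Perm (suc m) → Set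
BlockMonotone s e I σ = ∀ {a b} → a < b → slabel s I a ≡ slabel s I b → orient e _<_ (lookup σ a) (lookup σ b)

module _ {m} {σ : Perm (suc m)} (σ-inj : Inj (lookup σ)) where

  Des-false⁺ : ∀ j → lookup (Des σ) j ≡ false → lookup σ (inject₁ j) < lookup σ (suc j)
  Des-false⁺ j eq = Fin.≤∧≢⇒< (ℕ.≮⇒≥ (toWitnessFalse (from T-not-≡ (trans (sym (lookup∘tabulate _ j)) eq))))
    (λ same → ℕ.<-irrefl (trans (sym (Fin.toℕ-inject₁ j)) (cong toℕ (σ-inj same))) ℕ.≤-refl)

  Des-false⁻ : ∀ j → lookup σ (inject₁ j) < lookup σ (suc j) → lookup (Des σ) j ≡ false
  Des-false⁻ j lt = trans (lookup∘tabulate _ j) (to T-not-≡ (fromWitnessFalse (ℕ.<-asym lt)))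

  Des-true⁺ : ∀ j → lookup (Des σ) j ≡ true → lookup σ (suc j) < lookup σ (inject₁ j)
  Des-true⁺ j eq = toWitness (from T-≡ (trans (sym (lookup∘tabulate _ j)) eq))

  Des-true⁻ : ∀ j → lookup σ (suc j) < lookup σ (inject₁ j) → lookup (Des σ) j ≡ true
  Des-true⁻ j lt = trans (lookup∘tabulate _ j) (to T-≡ (fromWitness lt))

  Asc-lookup : ∀ j → lookup (Asc σ) j ≡ not (lookup (Des σ) j)
  Asc-lookup j = lookup-map j not (Des σ)

  -- Reflection turns a pair of neighbouring positions into another such pair in the opposite order;
  -- the outer `orient s` undoes this exchange.
  signedDes-false⁺ : ∀ s e j → lookup (signedDes s e σ) j ≡ false →
    orient s (orient e _<_) (lookup σ (mirror s (inject₁ j))) (lookup σ (mirror s (suc j)))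
  signedDes-false⁺ false false j eq = Des-false⁺ j eq
  signedDes-false⁺ false true  j eq = Des-true⁺ j (Boolₚ.not-injective (trans (sym (Asc-lookup j)) eq))
  signedDes-false⁺ true  false j eq rewrite opposite-inject₁ j =
    Des-false⁺ (opposite j) (trans (sym (lookup∘tabulate _ j)) eq)
  signedDes-false⁺ true  true  j eq rewrite opposite-inject₁ j =
    Des-true⁺ (opposite j) (Boolₚ.not-injective
      (trans (sym (Asc-lookup (opposite j))) (trans (sym (lookup∘tabulate _ j)) eq)))

  signedDes-false⁻ : ∀ s e j →
    orient s (orient e _<_) (lookup σ (mirror s (inject₁ j))) (lookup σ (mirror s (suc j))) →
    lookup (signedDes s e σ) j ≡ false
  signedDes-false⁻ false false j lt = Des-false⁻ j lt
  signedDes-false⁻ false true  j lt = trans (Asc-lookup j) (cong not (Des-true⁻ j lt))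
  signedDes-false⁻ true  false j lt rewrite opposite-inject₁ j =
    trans (lookup∘tabulate _ j) (Des-false⁻ (opposite j) lt)
  signedDes-false⁻ true  true  j lt rewrite opposite-inject₁ j =
    trans (lookup∘tabulate _ j) (trans (Asc-lookup (opposite j)) (cong not (Des-true⁻ (opposite j) lt)))

  -- Comparisons of neighbours spread over whole blocks; for `s = true` this happens along the
  -- reflected sequence, and the result is reflected back.
  ⊑⇒BlockMonotone : ∀ s e I → signedDes s e σ ⊑ I → BlockMonotone s e I σ
  ⊑⇒BlockMonotone s e I sub = unmirror s monotone
    where
    monotone : ∀ {a b} → a < b → label I a ≡ label I b →
      orient s (orient e _<_) (lookup σ (mirror s a)) (lookup σ (mirror s b))
    monotone = blocks-monotone {R = orient s (orient e _<_)} (orient-trans s (orient-trans e Fin.<-trans)) I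
      (lookup σ ∘ mirror s) (λ j → signedDes-false⁺ s e j ∘ sub j)
    unmirror : ∀ s → (∀ {a b} → a < b → label I a ≡ label I b →
      orient s (orient e _<_) (lookup σ (mirror s a)) (lookup σ (mirror s b))) → BlockMonotone s e I σ
    unmirror false mono a<b eq = mono a<b eq
    unmirror true  mono {a} {b} a<b eq =
      subst₂ (λ x y → orient e _<_ (lookup σ x) (lookup σ y))
        (Fin.opposite-involutive a) (Fin.opposite-involutive b) (mono (mirror-< true a<b) (sym eq))

  -- Where `I` has no cut, the two neighbouring positions share a block, so block monotonicity
  -- already compares their values.
  BlockMonotone⇒⊑ : ∀ s e I → BlockMonotone s e I σ → signedDes s e σ ⊑ I
  BlockMonotone⇒⊑ false e I mono j eq = signedDes-false⁻ false e j
    (mono (ℕ.s≤s (ℕ.≤-reflexive (Fin.toℕ-inject₁ j))) (label-adjacent I j eq))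
  BlockMonotone⇒⊑ true e I mono j eq = signedDes-false⁻ true e j
    (mono (mirror-< true (ℕ.s≤s (ℕ.≤-reflexive (Fin.toℕ-inject₁ j))))
      (trans (cong (label I) (mirror-involutive true (suc j)))
        (trans (sym (label-adjacent I j eq)) (cong (label I) (sym (mirror-involutive true (inject₁ j)))))))

-- Radix sort

suffix : ∀ {n k} → Vec (Perm n) k → Fin k → Fin n → Fin n
suffix (σ ∷ σs) zero    = lookup (prodₚ σs)
suffix (σ ∷ σs) (suc j) = suffix σs j

prod-∷ : ∀ {n k} (σ : Perm n) (σs : Vec (Perm n) k) p → lookup (prodₚ (σ ∷ σs)) p ≡ lookup σ (lookup (prodₚ σs) p)
prod-∷ σ σs p = lookup-map p (lookup σ) (prodₚ σs)

prod-inj : ∀ {n k} (σs : Vec (Perm n) k) → (∀ j → Inj (lookup (lookup σs j))) → Inj (lookup (prodₚ σs))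
prod-inj []       inj {x} {y} eq = trans (sym (lookup-allFin x)) (trans eq (lookup-allFin y))
prod-inj (σ ∷ σs) inj {x} {y} eq = prod-inj σs (inj ∘ suc)
  (inj zero (trans (sym (prod-∷ σ σs x)) (trans eq (prod-∷ σ σs y))))

suffix-inj : ∀ {n k} (σs : Vec (Perm n) k) → (∀ j → Inj (lookup (lookup σs j))) → ∀ j → Inj (suffix σs j)
suffix-inj (σ ∷ σs) inj zero    = prod-inj σs (inj ∘ suc)
suffix-inj (σ ∷ σs) inj (suc j) = suffix-inj σs (inj ∘ suc) j

ord : ∀ {n} → (Fin n → Fin n) → Rel (Fin n) 0ℓ
ord f p q = f p < f q

-- Object p occupies position suffix σs j p after pass j, and its j-th key is the label of that position.
key : ∀ {m k} → (Fin k → Bool) → (Fin k → Subset m) → Vec (Perm (suc m)) k → Fin k → Fin (suc m) → ℕ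
key s I σs j p = slabel (s j) (I j) (suffix σs j p)

record Admissible {m k} (s e : Fin k → Bool) (I : Fin k → Subset m) (σs : Vec (Perm (suc m)) k) : Set where
  constructor admissible
  field
    bijective : ∀ j → Inj (lookup (lookup σs j))
    monotone  : ∀ j → BlockMonotone (s j) (e j) (I j) (lookup σs j)

open Admissible

tail : ∀ {m k} {s e : Fin (suc k) → Bool} {I : Fin (suc k) → Subset m} {σ σs} →
  Admissible s e I (σ ∷ σs) → Admissible (s ∘ suc) (e ∘ suc) (I ∘ suc) σs
tail ad = admissible (bijective ad ∘ suc) (λ j → monotone ad (suc j))

-- Positions after the pass are given by the product of `σs`, those before it by applying `σ` once
-- more. Labels are weakly sorted along positions, and inside a block `σ` itself compares the
-- earlier positions.
pass-sorts : ∀ {m k} {s e : Fin (suc k) → Bool} {I : Fin (suc k) → Subset m} {σ} σs {p q} →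
  Admissible s e I (σ ∷ σs) → ord (lookup (prodₚ σs)) p q →
  step (s zero) (e zero) (key s I (σ ∷ σs) zero) (ord (lookup (prodₚ (σ ∷ σs)))) p q
pass-sorts {s = s} {e} {I} {σ} σs {p} {q} ad lt with ≤⇒<⊎≡ (s zero) (slabel-mono (s zero) (I zero) lt)
... | inj₁ l  = inj₁ l
... | inj₂ eq = inj₂ (eq , orient-map (e zero)
  (subst₂ _<_ (sym (prod-∷ σ σs p)) (sym (prod-∷ σ σs q)))
  (subst₂ _<_ (sym (prod-∷ σ σs q)) (sym (prod-∷ σ σs p))) (monotone ad zero lt eq))

-- After the last pass the remaining product is empty, so positions are the objects themselves. The
-- base order of the later passes is the order left by the first pass, which `pass-sorts` resolves
-- further.
passes-sort : ∀ {m k} {s e : Fin k → Bool} {I : Fin k → Subset m} σs {p q} → Admissible s e I σs →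
  p < q → lex s e (key s I σs) (ord (lookup (prodₚ σs))) p q
passes-sort [] {p} {q} ad p<q = subst₂ _<_ (sym (lookup-allFin p)) (sym (lookup-allFin q)) p<q
passes-sort {s = s} {e} (σ ∷ σs) ad p<q = lex-map (s ∘ suc) (e ∘ suc) (λ _ → refl) (λ _ → refl)
  (pass-sorts σs ad) (pass-sorts σs ad) (passes-sort σs (tail ad) p<q)

-- The initial order and the first key fix the order after the first pass, hence the products `ν`
-- and `ν′` of the remaining factors agree. Cancelling them from the common full product gives the
-- first factor, and induction the others.
keys-determine : ∀ {m k} {s e : Fin k → Bool} {I : Fin k → Subset m} σs τs →
  Admissible s e I σs → Admissible s e I τs →
  lookup (prodₚ σs) ≗ lookup (prodₚ τs) → (∀ j → key s I σs j ≗ key s I τs j) → σs ≡ τs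
keys-determine [] [] _ _ _ _ = refl
keys-determine {s = s} {e} {I} (σ ∷ σs) (τ ∷ τs) adσ adτ same-prod same-key =
  cong₂ _∷_ σ≡τ (keys-determine σs τs (tail adσ) (tail adτ) ν≗ν′ (same-key ∘ suc))
  where
  ν  = lookup (prodₚ σs)
  ν′ = lookup (prodₚ τs)
  ν-inj : Inj ν
  ν-inj = prod-inj σs (bijective (tail adσ))
  ν′-inj : Inj ν′
  ν′-inj = prod-inj τs (bijective (tail adτ))
  transfer-step : ∀ {p q} → ν′ p < ν′ q →
    step (s zero) (e zero) (key s I (σ ∷ σs) zero) (ord (lookup (prodₚ (σ ∷ σs)))) p q
  transfer-step {p} {q} lt = step-map (s zero) (e zero) (sym (same-key zero p)) (sym (same-key zero q))
    (subst₂ _<_ (sym (same-prod p)) (sym (same-prod q))) (subst₂ _<_ (sym (same-prod q)) (sym (same-prod p)))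
    (pass-sorts τs adτ lt)
  same-order : ∀ {p q} → ν p < ν q → ν′ p < ν′ q
  same-order {p} {q} lt with Fin.<-cmp (ν′ p) (ν′ q)
  ... | tri< lt′ _ _ = lt′
  ... | tri≈ _ eq _ = contradiction lt (Fin.<-irrefl (cong ν (ν′-inj eq)))
  -- Opposite orders after the first pass would order `p` and `q` both ways in the same strict
  -- order.
  ... | tri> _ _ gt = ⊥-elim (proj₂ (step-antisym (s zero) (e zero) _ ℕ.<-asym
    (pass-sorts σs adσ lt) (transfer-step gt)))
  ν≗ν′ : ν ≗ ν′
  ν≗ν′ = same-order⇒≗ ν-inj ν′-inj same-order
  agree : ∀ x → lookup σ x ≡ lookup τ x
  agree x with y , refl ← injective⇒surjective ν-inj x = begin
    lookup σ (ν y)              ≡⟨ prod-∷ σ σs y ⟨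
    lookup (prodₚ (σ ∷ σs)) y   ≡⟨ same-prod y ⟩
    lookup (prodₚ (τ ∷ τs)) y   ≡⟨ prod-∷ τ τs y ⟩
    lookup τ (ν′ y)             ≡⟨ cong (lookup τ) (ν≗ν′ y) ⟨
    lookup τ (ν y)              ∎
    where open ≡-Reasoning
  σ≡τ : σ ≡ τ
  σ≡τ = trans (sym (tabulate∘lookup σ)) (trans (tabulate-cong agree) (tabulate∘lookup τ))

IsIdentity : ∀ {n k} → Vec (Perm n) k → Set
IsIdentity σs = ∀ p → lookup (prodₚ σs) p ≡ p

identity-sorted : ∀ {m k} {s e : Fin k → Bool} {I : Fin k → Subset m} σs {p q} → Admissible s e I σs →
  IsIdentity σs → p < q → lex s e (key s I σs) _<_ p q
identity-sorted {s = s} {e} σs {p} {q} ad idn p<q = lex-map s e (λ _ → refl) (λ _ → refl)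
  (subst₂ _<_ (idn p) (idn q)) (subst₂ _<_ (idn q) (idn p)) (passes-sort σs ad p<q)

-- Both families list the same multiset of key tuples in sorted order, hence they agree object by
-- object, and `keys-determine` applies.
rearranged-keys-determine : ∀ {m k} {s e : Fin k → Bool} {I : Fin k → Subset m} σs τs →
  Admissible s e I σs → Admissible s e I τs → IsIdentity σs → IsIdentity τs →
  (h : Fin (suc m) → Fin (suc m)) → Inj h → (∀ j p → key s I τs j p ≡ key s I σs j (h p)) → σs ≡ τs
rearranged-keys-determine {m} {s = s} {e} {I} σs τs adσ adτ idσ idτ h h-inj keys =
  keys-determine σs τs adσ adτ (λ p → trans (idσ p) (sym (idτ p)))
    (λ j p → trans (proj₁ (lex-antisym s e w (λ _ _ → tt) (proj₁ (agree p)) (proj₂ (agree p))) j) (sym (keys j p)))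
  where
  w = key s I σs
  -- The trivial base relation leaves a preorder that compares key tuples alone.
  _≼_ : Rel (Fin (suc m)) 0ℓ
  _≼_ = lex s e w (λ _ _ → ⊤)
  agree : ∀ p → p ≼ h p × h p ≼ p
  agree = rearrangement-agrees {_≼_ = _≼_} h-inj (lex-refl s e w tt) (lex-trans s e w (λ _ _ → tt))
    (λ p<q → lex-map s e (λ _ → refl) (λ _ → refl) _ _ (identity-sorted σs adσ idσ p<q))
    (λ {p} {q} p<q → lex-map s e (λ j → keys j p) (λ j → keys j q) _ _ (identity-sorted τs adτ idτ p<q))

-- Construction of factorizations from prescribed keys

Rearranges : ∀ {m} → Subset m → (Fin (suc m) → ℕ) → Set
Rearranges I w = ∃ λ c → Inj c × (∀ p → w p ≡ label I (c p))

-- One pass starting from the positions `f₀`: ranks in the order `step` are the new positions, and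
-- `passPerm` carries new positions back to old ones.
module Pass {m} (s e : Bool) (I : Subset m) (w : Fin (suc m) → ℕ) (content : Rearranges I w)
            {f₀ : Fin (suc m) → Fin (suc m)} (f₀-inj : Inj f₀) where

  private
    c = proj₁ content
    f₀-total : ∀ {p q} → p ≢ q → f₀ p < f₀ q ⊎ f₀ q < f₀ p
    f₀-total {p} {q} p≢q with Fin.<-cmp (f₀ p) (f₀ q)
    ... | tri< lt _ _ = inj₁ lt
    ... | tri≈ _ eq _ = contradiction (f₀-inj eq) p≢q
    ... | tri> _ _ gt = inj₂ gt

  open Rank {R = step s e w (ord f₀)} (step-dec s e w (λ p q → f₀ p Fin.<? f₀ q))
    (step-trans s e w (λ {i} {j} {k} → ℕ.<-trans {toℕ (f₀ i)} {toℕ (f₀ j)}))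
    (λ {p} r → proj₂ (step-antisym s e w {p = p} ℕ.<-asym r r)) (step-total s e w ∘ f₀-total) public

  open Inverse rank-inj renaming (f⁻¹ to unrank; f∘f⁻¹ to rank∘unrank; f⁻¹∘f to unrank∘rank; f⁻¹-inj to unrank-inj) public

  unrank-step : ∀ {a b} → a < b → step s e w (ord f₀) (unrank a) (unrank b)
  unrank-step {a} {b} a<b = rank-cancel (subst₂ _<_ (sym (rank∘unrank a)) (sym (rank∘unrank b)) a<b)

  -- Read along the new positions, the keys and the labels are two sorted lists of the same values,
  -- so they coincide.
  key-rank : ∀ p → w p ≡ slabel s I (rank p)
  key-rank p = trans (w-slabel p) (trans (cong (λ x → slabel s I (mirror s (c x))) (sym (unrank∘rank p)))
      (≼-antisym s (agree (rank p))))
    where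
    w-slabel : ∀ p → w p ≡ slabel s I (mirror s (c p))
    w-slabel p = trans (proj₂ (proj₂ content) p) (cong (label I) (sym (mirror-involutive s (c p))))
    _≼_ : Rel (Fin (suc m)) 0ℓ
    x ≼ y = orient s _≤_ (slabel s I x) (slabel s I y)
    agree : ∀ a → a ≼ mirror s (c (unrank a)) × mirror s (c (unrank a)) ≼ a
    agree = rearrangement-agrees {_≼_ = _≼_} (unrank-inj ∘ proj₁ (proj₂ content) ∘ mirror-inj s)
      (orient-reflexive s ℕ.≤-reflexive refl) (orient-trans s ℕ.≤-trans) (slabel-mono s I)
      (λ {a} {b} a<b → subst₂ (orient s _≤_) (w-slabel (unrank a)) (w-slabel (unrank b))
        (step⇒≤ s e w (unrank-step a<b)))
    ≼-antisym : ∀ s {x y} → orient s _≤_ y x × orient s _≤_ x y → x ≡ y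
    ≼-antisym false (le , ge) = ℕ.≤-antisym ge le
    ≼-antisym true  (le , ge) = ℕ.≤-antisym le ge

  passPerm : Perm (suc m)
  passPerm = tabulate (f₀ ∘ unrank)

  lookup-passPerm : ∀ a → lookup passPerm a ≡ f₀ (unrank a)
  lookup-passPerm = lookup∘tabulate (f₀ ∘ unrank)

  passPerm-rank : ∀ p → lookup passPerm (rank p) ≡ f₀ p
  passPerm-rank p = trans (lookup-passPerm (rank p)) (cong f₀ (unrank∘rank p))

  passPerm-inj : Inj (lookup passPerm)
  passPerm-inj {x} {y} eq = unrank-inj (f₀-inj
    (trans (sym (lookup-passPerm x)) (trans eq (lookup-passPerm y))))

  passPerm-monotone : BlockMonotone s e I passPerm
  passPerm-monotone {a} {b} a<b eq = orient-map e
    (subst₂ _<_ (sym (lookup-passPerm a)) (sym (lookup-passPerm b)))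
    (subst₂ _<_ (sym (lookup-passPerm b)) (sym (lookup-passPerm a)))
    (step-eq s e w same-key (unrank-step a<b))
    where
    key-unrank : ∀ a → w (unrank a) ≡ slabel s I a
    key-unrank a = trans (key-rank (unrank a)) (cong (slabel s I) (rank∘unrank a))
    same-key : w (unrank a) ≡ w (unrank b)
    same-key = trans (key-unrank a) (trans eq (sym (key-unrank b)))

-- Here `f₀` gives the positions before the first pass and `f` those after the last one.
record RadixSort {m k} (s e : Fin k → Bool) (I : Fin k → Subset m) (w : Fin k → Fin (suc m) → ℕ)
                 (f₀ : Fin (suc m) → Fin (suc m)) : Set where
  field
    σs       : Vec (Perm (suc m)) k
    ad       : Admissible s e I σs
    f        : Fin (suc m) → Fin (suc m)
    f-inj    : Inj f
    sorts    : ∀ {p q} → lex s e w (ord f₀) p q → f p < f q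
    sorted   : ∀ {p q} → f p < f q → lex s e w (ord f₀) p q
    product  : ∀ p → lookup (prodₚ σs) (f p) ≡ f₀ p
    keys     : ∀ j p → w j p ≡ key s I σs j (f p)

radixSort : ∀ {m k} (s e : Fin k → Bool) (I : Fin k → Subset m) (w : Fin k → Fin (suc m) → ℕ) →
  (∀ j → Rearranges (I j) (w j)) → {f₀ : Fin (suc m) → Fin (suc m)} → Inj f₀ → RadixSort s e I w f₀
radixSort {k = zero} s e I w content {f₀} f₀-inj = record
  { σs = [] ; ad = admissible (λ ()) (λ ()) ; f = f₀ ; f-inj = f₀-inj ; sorts = id ; sorted = id
  ; product = λ p → lookup-allFin (f₀ p) ; keys = λ () }
radixSort {k = suc k} s e I w content {f₀} f₀-inj = record
  { σs = passPerm ∷ σs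
  ; ad = admissible (λ { zero → passPerm-inj ; (suc j) → bijective ad j })
                    (λ { zero → passPerm-monotone ; (suc j) → monotone ad j })
  ; f = f ; f-inj = f-inj
  ; sorts = λ r → sorts (lex-map (s ∘ suc) (e ∘ suc) (λ _ → refl) (λ _ → refl) rank-mono rank-mono r)
  ; sorted = λ lt → lex-map (s ∘ suc) (e ∘ suc) (λ _ → refl) (λ _ → refl) rank-cancel rank-cancel (sorted lt)
  ; product = λ p → trans (prod-∷ passPerm σs (f p)) (trans (cong (lookup passPerm) (product p)) (passPerm-rank p))
  -- By `product` for the remaining passes, the position of `p` right after the first pass is its
  -- rank.
  ; keys = λ { zero p → trans (key-rank p) (cong (slabel (s zero) (I zero)) (sym (product p)))
             ; (suc j) p → keys j p } }
  where
  open Pass (s zero) (e zero) (I zero) (w zero) (content zero) f₀-inj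
  open RadixSort (radixSort (s ∘ suc) (e ∘ suc) (I ∘ suc) (w ∘ suc) (content ∘ suc) rank-inj)

-- Sorting a second time changes nothing: either the sort is stable overall, or no two objects share all keys.
fixedOrder : ∀ {m k} (s e : Fin k → Bool) (I : Fin k → Subset m) (w : Fin k → Fin (suc m) → ℕ) →
  (∀ j → Rearranges (I j) (w j)) →
  (xorSum e ≡ true → ∀ {p q} → (∀ j → w j p ≡ w j q) → p ≡ q) →
  ∃₂ λ σs g → Admissible s e I σs × IsIdentity σs × Inj g × (∀ j p → w j p ≡ key s I σs j (g p))
fixedOrder s e I w content distinct =
  σs , g , ad , is-identity , g-inj , λ j p → trans (keys j p) (cong (key s I σs j) (f≗g p))
  where
  -- The first sort only supplies the order `g`. The second starts from `g` and provides the
  -- factors; their product is 1 because it also ends at `g`.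
  open RadixSort (radixSort s e I w content {id} id)
    using () renaming (f to g; f-inj to g-inj; sorts to g-sorts)
  open RadixSort (radixSort s e I w content g-inj)
  tie : ∀ b → xorSum e ≡ b → ∀ {p q} → (∀ j → w j p ≡ w j q) → orient b (ord g) p q → g p < g q
  tie false eq same lt = lt
  tie true  eq {p} same lt = contradiction lt (Fin.<-irrefl (cong g (sym (distinct eq same))))
  resort : ∀ {p q} → lex s e w (ord g) p q → g p < g q
  resort {p} {q} r with Fin.any? (λ j → ¬? (w j p ℕ.≟ w j q))
  -- A differing key decides whatever the starting order is, so the verdict of the first sort
  -- carries over.
  ... | yes (j , neq) = g-sorts (lex-distinct-keys s e w j neq r)
  ... | no  none = tie (xorSum e) refl same (lex-equal-keys s e w same r)
    where
    same : ∀ j → w j p ≡ w j q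
    same j with w j p ℕ.≟ w j q
    ... | yes eq = eq
    ... | no neq = contradiction (j , neq) none
  f≗g : f ≗ g
  f≗g = same-order⇒≗ f-inj g-inj (resort ∘ sorted)
  is-identity : IsIdentity σs
  is-identity x with y , refl ← injective⇒surjective f-inj x = trans (product y) (sym (f≗g y))

-- An odd number of tie reversals would put two objects with equal keys in the order opposite to
-- their natural one, although the product is 1.
identity-distinct-keys : ∀ {m k} {s e : Fin k → Bool} {I : Fin k → Subset m} σs → Admissible s e I σs →
  IsIdentity σs → xorSum e ≡ true → ∀ {p q} → (∀ j → key s I σs j p ≡ key s I σs j q) → p ≡ q
identity-distinct-keys {s = s} {e} {I} σs ad idn odd {p} {q} same with Fin.<-cmp p q
... | tri≈ _ eq _ = eq
... | tri< lt _ _ = ⊥-elim (Fin.<-asym lt (subst (λ b → orient b _<_ p q) odd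
        (lex-equal-keys s e (key s I σs) same (identity-sorted σs ad idn lt))))
... | tri> _ _ gt = ⊥-elim (Fin.<-asym gt (subst (λ b → orient b _<_ q p) odd
        (lex-equal-keys s e (key s I σs) (sym ∘ same) (identity-sorted σs ad idn gt))))

keys-rearrange : ∀ {m k} {s e : Fin k → Bool} {I : Fin k → Subset m} σs → Admissible s e I σs →
  ∀ j → Rearranges (I j) (key s I σs j)
keys-rearrange {s = s} σs ad j =
  mirror (s j) ∘ suffix σs j , suffix-inj σs (bijective ad) j ∘ mirror-inj (s j) , λ _ → refl

-- Counting

count : {A : Set} → (A → Bool) → List A → ℕ
count p xs = length (filterᵇ p xs)

count-cong : ∀ {A : Set} {p q : A → Bool} → p ≗ q → count p ≗ count q
count-cong eq [] = refl
count-cong {p = p} {q} eq (x ∷ xs) with p x | q x | eq x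
... | true  | _ | refl = cong suc (count-cong eq xs)
... | false | _ | refl = count-cong eq xs

count-∧ : ∀ {A : Set} (p q : A → Bool) xs → count (λ x → p x ∧ q x) xs ≡ count q (filterᵇ p xs)
count-∧ p q [] = refl
count-∧ p q (x ∷ xs) with p x
... | false = count-∧ p q xs
... | true with q x
...   | false = count-∧ p q xs
...   | true  = cong suc (count-∧ p q xs)

count-split : ∀ {A : Set} (p q : A → Bool) xs →
  count q xs ≡ count q (filterᵇ (not ∘ p) xs) ℕ.+ count q (filterᵇ p xs)
count-split p q [] = refl
count-split p q (x ∷ xs) with p x
... | true with q x
...   | false = count-split p q xs
...   | true  = trans (cong suc (count-split p q xs)) (sym (ℕ.+-suc _ _))
count-split p q (x ∷ xs) | false with q x
...   | false = count-split p q xs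
...   | true  = cong suc (count-split p q xs)

-- Möbius inversion over bit vectors

_⊑ᵇ_ : ∀ {M} → (Fin M → Bool) → (Fin M → Bool) → Bool
_⊑ᵇ_ {zero}  d S = true
_⊑ᵇ_ {suc M} d S = (not (d zero) ∨ S zero) ∧ ((d ∘ suc) ⊑ᵇ (S ∘ suc))

_==ᵇ_ : ∀ {M} → (Fin M → Bool) → (Fin M → Bool) → Bool
_==ᵇ_ {zero}  d S = true
_==ᵇ_ {suc M} d S = not (d zero xor S zero) ∧ ((d ∘ suc) ==ᵇ (S ∘ suc))

⊑ᵇ⁺ : ∀ {M} {d S : Fin M → Bool} → (∀ x → S x ≡ false → d x ≡ false) → T (d ⊑ᵇ S)
⊑ᵇ⁺ {zero} h = tt
⊑ᵇ⁺ {suc M} {d} {S} h = from T-∧ (bit (d zero) (S zero) (h zero) , ⊑ᵇ⁺ (h ∘ suc))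
  where
  bit : ∀ a b → (b ≡ false → a ≡ false) → T (not a ∨ b)
  bit false b     h = tt
  bit true  true  h = tt
  bit true  false h = contradiction (h refl) λ ()

⊑ᵇ⁻ : ∀ {M} {d S : Fin M → Bool} → T (d ⊑ᵇ S) → ∀ x → S x ≡ false → d x ≡ false
⊑ᵇ⁻ {suc M} {d} {S} t zero eq = bit (d zero) eq (proj₁ (to T-∧ t))
  where
  bit : ∀ a {b} → b ≡ false → T (not a ∨ b) → a ≡ false
  bit false _ _ = refl
  bit true refl ()
⊑ᵇ⁻ {suc M} {d} {S} t (suc x) eq = ⊑ᵇ⁻ (proj₂ (to (T-∧ {not (d zero) ∨ S zero}) t)) x eq

==ᵇ⁺ : ∀ {M} {d S : Fin M → Bool} → d ≗ S → T (d ==ᵇ S)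
==ᵇ⁺ {zero} h = tt
==ᵇ⁺ {suc M} {d} {S} h = from T-∧ (bit (h zero) , ==ᵇ⁺ (h ∘ suc))
  where
  bit : ∀ {a b} → a ≡ b → T (not (a xor b))
  bit {false} refl = tt
  bit {true}  refl = tt

==ᵇ⁻ : ∀ {M} {d S : Fin M → Bool} → T (d ==ᵇ S) → d ≗ S
==ᵇ⁻ {suc M} {d} {S} t zero = bit (d zero) (S zero) (proj₁ (to T-∧ t))
  where
  bit : ∀ a b → T (not (a xor b)) → a ≡ b
  bit false false _ = refl
  bit true  true  _ = refl
==ᵇ⁻ {suc M} {d} {S} t (suc x) = ==ᵇ⁻ (proj₂ (to (T-∧ {not (d zero xor S zero)}) t)) x

private
  _◂_ : ∀ {M} → Bool → (Fin M → Bool) → Fin (suc M) → Bool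
  (b ◂ S) zero    = b
  (b ◂ S) (suc x) = S x

  count-⊑-false : ∀ {A : Set} {M} (d : A → Fin (suc M) → Bool) I xs →
    count (λ x → d x ⊑ᵇ (false ◂ I)) xs ≡ count (λ x → (d x ∘ suc) ⊑ᵇ I) (filterᵇ (λ x → not (d x zero)) xs)
  count-⊑-false d I xs = trans
    (count-cong (λ x → cong (_∧ ((d x ∘ suc) ⊑ᵇ I)) (Boolₚ.∨-identityʳ (not (d x zero)))) xs)
    (count-∧ (λ x → not (d x zero)) _ xs)

  count-⊑-true : ∀ {A : Set} {M} (d : A → Fin (suc M) → Bool) I xs →
    count (λ x → d x ⊑ᵇ (true ◂ I)) xs ≡
      count (λ x → (d x ∘ suc) ⊑ᵇ I) (filterᵇ (λ x → not (d x zero)) xs) ℕ.+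
      count (λ x → (d x ∘ suc) ⊑ᵇ I) (filterᵇ (λ x → d x zero) xs)
  count-⊑-true d I xs = trans
    (count-cong (λ x → cong (_∧ ((d x ∘ suc) ⊑ᵇ I)) (Boolₚ.∨-zeroʳ (not (d x zero)))) xs)
    (count-split (λ x → d x zero) _ xs)

  count-==-false : ∀ {A : Set} {M} (d : A → Fin (suc M) → Bool) S xs → S zero ≡ false →
    count (λ x → d x ==ᵇ S) xs ≡ count (λ x → (d x ∘ suc) ==ᵇ (S ∘ suc)) (filterᵇ (λ x → not (d x zero)) xs)
  count-==-false d S xs eq = trans
    (count-cong (λ x → cong (λ b → not b ∧ ((d x ∘ suc) ==ᵇ (S ∘ suc)))
      (trans (cong (d x zero xor_) eq) (Boolₚ.xor-identityʳ (d x zero)))) xs)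
    (count-∧ (λ x → not (d x zero)) _ xs)

  count-==-true : ∀ {A : Set} {M} (d : A → Fin (suc M) → Bool) S xs → S zero ≡ true →
    count (λ x → d x ==ᵇ S) xs ≡ count (λ x → (d x ∘ suc) ==ᵇ (S ∘ suc)) (filterᵇ (λ x → d x zero) xs)
  count-==-true d S xs eq = trans
    (count-cong (λ x → cong (_∧ ((d x ∘ suc) ==ᵇ (S ∘ suc))) (not-xor-true (d x zero) eq)) xs)
    (count-∧ (λ x → d x zero) _ xs)
    where
    not-xor-true : ∀ a {b} → b ≡ true → not (a xor b) ≡ a
    not-xor-true false refl = refl
    not-xor-true true  refl = refl

-- Induction on the bits: a bound with head `false` selects the elements whose first bit is off, and
-- a bound with head `true` leaves that bit free. Subtracting isolates those whose first bit is on,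
-- so both halves satisfy the hypothesis.
möbius : ∀ {A B : Set} {M} (d : A → Fin M → Bool) (d′ : B → Fin M → Bool) xs ys →
  (∀ I → count (λ x → d x ⊑ᵇ I) xs ≡ count (λ y → d′ y ⊑ᵇ I) ys) →
  ∀ S → count (λ x → d x ==ᵇ S) xs ≡ count (λ y → d′ y ==ᵇ S) ys
möbius {M = zero}  d d′ xs ys h S = h S
möbius {M = suc M} d d′ xs ys h S = by-head (S zero) refl
  where
  xs₀ = filterᵇ (λ x → not (d x zero)) xs
  xs₁ = filterᵇ (λ x → d x zero) xs
  ys₀ = filterᵇ (λ y → not (d′ y zero)) ys
  ys₁ = filterᵇ (λ y → d′ y zero) ys
  h-false : ∀ I → count (λ x → (d x ∘ suc) ⊑ᵇ I) xs₀ ≡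
                  count (λ y → (d′ y ∘ suc) ⊑ᵇ I) ys₀
  h-false I = trans (sym (count-⊑-false d I xs)) (trans (h (false ◂ I)) (count-⊑-false d′ I ys))
  h-true : ∀ I → count (λ x → (d x ∘ suc) ⊑ᵇ I) xs₁ ≡
                 count (λ y → (d′ y ∘ suc) ⊑ᵇ I) ys₁
  h-true I = ℕ.+-cancelˡ-≡ (count (λ x → (d x ∘ suc) ⊑ᵇ I) xs₀) _ _
    (trans (sym (count-⊑-true d I xs)) (trans (h (true ◂ I)) (trans (count-⊑-true d′ I ys)
      (cong (ℕ._+ _) (sym (h-false I))))))
  by-head : ∀ b → S zero ≡ b → count (λ x → d x ==ᵇ S) xs ≡ count (λ y → d′ y ==ᵇ S) ys
  by-head false eq = trans (count-==-false d S xs eq) (trans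
    (möbius (λ x → d x ∘ suc) (λ y → d′ y ∘ suc) xs₀ ys₀ h-false (S ∘ suc)) (sym (count-==-false d′ S ys eq)))
  by-head true  eq = trans (count-==-true d S xs eq) (trans
    (möbius (λ x → d x ∘ suc) (λ y → d′ y ∘ suc) xs₁ ys₁ h-true (S ∘ suc)) (sym (count-==-true d′ S ys eq)))

-- Pigeonhole by induction: remove from `ys` a partner of the first element. A relation suffices, so
-- that partners need not be chosen by a function.
injection⇒length≤ : ∀ {A B : Set} {R : A → B → Set} {xs : List A} {ys : List B} → Unique xs →
  (∀ {x} → x ∈ₗ xs → ∃ λ y → y ∈ₗ ys × R x y) →
  (∀ {x x′ y} → x ∈ₗ xs → x′ ∈ₗ xs → R x y → R x′ y → x ≡ x′) → length xs ≤ length ys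
injection⇒length≤ {xs = []} _ _ _ = z≤n
injection⇒length≤ {R = R} {x ∷ xs} {ys} unique@(_ ∷ unique′) total injective
  with y , y∈ys , Rxy ← total (here refl)
  with as , bs , refl ← ∈ₗ.∈-∃++ y∈ys = subst (suc (length xs) ≤_) (sym length-insert)
    (s≤s (injection⇒length≤ {R = R} unique′ total′ (λ x∈ x′∈ → injective (there x∈) (there x′∈))))
  where
  length-insert : length (as ++ [ y ] ++ bs) ≡ suc (length (as ++ bs))
  length-insert = trans (length-++ as) (trans (ℕ.+-suc (length as) (length bs)) (cong suc (sym (length-++ as))))
  total′ : ∀ {x′} → x′ ∈ₗ xs → ∃ λ y′ → y′ ∈ₗ as ++ bs × R x′ y′
  total′ {x′} x′∈ with y′ , y′∈ , Rx′y′ ← total (there x′∈) with ∈ₗ.∈-++⁻ as y′∈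
  ... | inj₁ y′∈as = y′ , ∈ₗ.∈-++⁺ˡ y′∈as , Rx′y′
  ... | inj₂ (there y′∈bs) = y′ , ∈ₗ.∈-++⁺ʳ as y′∈bs , Rx′y′
  -- The removed partner cannot serve again: injectivity would make `x′` equal to `x`, which does
  -- not recur in `xs`.
  ... | inj₂ (here refl) = contradiction
    (subst (_∈ₗ xs) (injective (there x′∈) (here refl) Rx′y′ Rxy) x′∈) (Unique.Unique[x∷xs]⇒x∉xs unique)

-- Enumeration of vectors and permutations

vecsOver-suc : ∀ {A : Set} (xs : List A) k → vecsOver xs (suc k) ≡ cartesianProductWith _∷_ xs (vecsOver xs k)
vecsOver-suc xs k = go xs
  where
  go : ∀ ys → concatMap (λ x → map (x ∷_) (vecsOver xs k)) ys ≡ cartesianProductWith _∷_ ys (vecsOver xs k)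
  go []       = refl
  go (y ∷ ys) = cong (map (y ∷_) (vecsOver xs k) ++_) (go ys)

vecsOver-unique : ∀ {A : Set} {xs : List A} k → Unique xs → Unique (vecsOver xs k)
vecsOver-unique zero    xs! = All.[] ∷ []
vecsOver-unique {xs = xs} (suc k) xs! = subst Unique (sym (vecsOver-suc xs k))
  (Unique.cartesianProductWith⁺ _∷_ ∷-injective xs! (vecsOver-unique k xs!))

∈-vecsOver⁺ : ∀ {A : Set} {xs : List A} {k} (v : Vec A k) → (∀ j → lookup v j ∈ₗ xs) → v ∈ₗ vecsOver xs k
∈-vecsOver⁺ []      h = here refl
∈-vecsOver⁺ {xs = xs} {suc k} (x ∷ v) h = subst (_ ∈ₗ_) (sym (vecsOver-suc xs k))
  (∈ₗ.∈-cartesianProductWith⁺ _∷_ (h zero) (∈-vecsOver⁺ v (h ∘ suc)))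

∈-vecsOver⁻ : ∀ {A : Set} {xs : List A} {k} {v : Vec A k} → v ∈ₗ vecsOver xs k → ∀ j → lookup v j ∈ₗ xs
∈-vecsOver⁻ {xs = xs} {suc k} v∈ j
  with _ , _ , x∈ , v′∈ , refl ← ∈ₗ.∈-cartesianProductWith⁻ _∷_ xs (vecsOver xs k) (subst (_ ∈ₗ_) (vecsOver-suc xs k) v∈)
  with j
... | zero   = x∈
... | suc j′ = ∈-vecsOver⁻ v′∈ j′

allᵇ-allFin⁺ : ∀ {k} (p : Fin k → Bool) → (∀ i → T (p i)) → T (allᵇ p (List.allFin k))
allᵇ-allFin⁺ p h = All.all⁻ p (All.tabulate⁺ h)

allᵇ-allFin⁻ : ∀ {k} (p : Fin k → Bool) → T (allᵇ p (List.allFin k)) → ∀ i → T (p i)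
allᵇ-allFin⁻ p t i = All.lookup (All.all⁺ p _ t) (∈ₗ.∈-allFin i)

injectiveᵇ⁺ : ∀ {n} (v : Perm n) → Inj (lookup v) → T (injectiveᵇ v)
injectiveᵇ⁺ v inj = allᵇ-allFin⁺ _ λ a → allᵇ-allFin⁺ _ λ b → pair a b
  where
  pair : ∀ a b → T (not ⌊ lookup v a Fin.≟ lookup v b ⌋ ∨ ⌊ a Fin.≟ b ⌋)
  pair a b with lookup v a Fin.≟ lookup v b
  ... | no  _  = tt
  ... | yes eq = fromWitness (inj eq)

injectiveᵇ⁻ : ∀ {n} (v : Perm n) → T (injectiveᵇ v) → Inj (lookup v)
injectiveᵇ⁻ v t {a} {b} eq with lookup v a Fin.≟ lookup v b | allᵇ-allFin⁻ _ (allᵇ-allFin⁻ _ t a) b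
... | no neq | _ = contradiction eq neq
... | yes _  | r = toWitness r

Sym-unique : ∀ n → Unique (Sym n)
Sym-unique n = Unique.filter⁺ (T? ∘ injectiveᵇ) (vecsOver-unique n (Unique.allFin⁺ n))

∈-Sym⁺ : ∀ {n} {v : Perm n} → Inj (lookup v) → v ∈ₗ Sym n
∈-Sym⁺ {v = v} inj = ∈ₗ.∈-filter⁺ (T? ∘ injectiveᵇ) (∈-vecsOver⁺ v (λ j → ∈ₗ.∈-allFin (lookup v j))) (injectiveᵇ⁺ v inj)

∈-Sym⁻ : ∀ {n} {v : Perm n} → v ∈ₗ Sym n → Inj (lookup v)
∈-Sym⁻ {n} {v} v∈ = injectiveᵇ⁻ v (proj₂ (∈ₗ.∈-filter⁻ (T? ∘ injectiveᵇ) {xs = vecsOver (List.allFin n) n} v∈))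

-- The equivalence of two configurations

identityᵇ : ∀ {m k} → Vec (Perm (suc m)) k → Bool
identityᵇ σs = ⌊ ≡-dec Fin._≟_ (prodₚ σs) idₚ ⌋

factorizations : ∀ m k → List (Vec (Perm (suc m)) k)
factorizations m k = filterᵇ identityᵇ (vecsOver (Sym (suc m)) k)

∈-factorizations⁺ : ∀ {m k} {σs : Vec (Perm (suc m)) k} → (∀ j → Inj (lookup (lookup σs j))) → IsIdentity σs →
  σs ∈ₗ factorizations m k
∈-factorizations⁺ {σs = σs} inj idn = ∈ₗ.∈-filter⁺ (T? ∘ identityᵇ) (∈-vecsOver⁺ σs (∈-Sym⁺ ∘ inj))
  (fromWitness (trans (sym (tabulate∘lookup (prodₚ σs))) (tabulate-cong idn)))

∈-factorizations⁻ : ∀ {m k} {σs : Vec (Perm (suc m)) k} → σs ∈ₗ factorizations m k →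
  (∀ j → Inj (lookup (lookup σs j))) × IsIdentity σs
∈-factorizations⁻ {m} {k} {σs} σs∈
  with σs∈′ , t ← ∈ₗ.∈-filter⁻ (T? ∘ identityᵇ) {xs = vecsOver (Sym (suc m)) k} σs∈ =
  (λ j → ∈-Sym⁻ (∈-vecsOver⁻ σs∈′ j)) ,
  λ p → trans (cong (λ v → lookup v p) (toWitness {a? = ≡-dec Fin._≟_ (prodₚ σs) idₚ} t)) (lookup-allFin p)

-- Slot i of the configuration constrains the factor σ_{π(i)}; the superscript ʲ marks data
-- indexed by the position j = π(i) of the factor.
record Configuration (k : ℕ) : Set where
  field
    s e : Fin k → Bool
    π   : Permutation′ k

  sʲ eʲ : Fin k → Bool
  sʲ j = s (π ⟨$⟩ˡ j)
  eʲ j = e (π ⟨$⟩ˡ j)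

  bits : ∀ {m} → Vec (Perm (suc m)) k → Fin k → Subset m
  bits σs i = signedDes (s i) (e i) (lookup σs (π ⟨$⟩ʳ i))

  -- XOR is commutative, so the order of the passes does not affect the parity of the tie reversals.
  parity : xorSum eʲ ≡ xorSum e
  parity = sym (xorSum-permute e (Permutation.flip π))

  -- All `k` statistics form a single bit vector, so that one Möbius inversion treats them together.
  flatBits : ∀ {m} → Vec (Perm (suc m)) k → Fin (k ℕ.* m) → Bool
  flatBits {m} σs x = uncurry (λ i → lookup (bits σs i)) (remQuot m x)

open Configuration

unflatten : ∀ {m k} → (Fin (k ℕ.* m) → Bool) → Fin k → Subset m
unflatten I i = tabulate (λ j → I (combine i j))

factorizationsBelow : ∀ {m k} → Configuration k → (Fin (k ℕ.* m) → Bool) → List (Vec (Perm (suc m)) k)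
factorizationsBelow {m} {k} c I = filterᵇ (λ σs → flatBits c σs ⊑ᵇ I) (factorizations m k)

module _ {m k} (c : Configuration k) (I : Fin (k ℕ.* m) → Bool) where

  Iʲ : Fin k → Subset m
  Iʲ j = unflatten I (π c ⟨$⟩ˡ j)

  flatBits⇒⊑ : ∀ {σs} → T (flatBits c σs ⊑ᵇ I) → ∀ i → bits c σs i ⊑ unflatten I i
  flatBits⇒⊑ {σs} t i j eq = trans (sym (cong (uncurry (λ i → lookup (bits c σs i))) (Fin.remQuot-combine i j)))
    (⊑ᵇ⁻ t (combine i j) (trans (sym (lookup∘tabulate _ j)) eq))

  ⊑⇒flatBits : ∀ {σs} → (∀ i → bits c σs i ⊑ unflatten I i) → T (flatBits c σs ⊑ᵇ I)
  ⊑⇒flatBits sub = ⊑ᵇ⁺ λ x eq → sub _ _ (trans (lookup∘tabulate _ (proj₂ (remQuot {k} m x)))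
    (trans (cong I (Fin.combine-remQuot {k} m x)) eq))

  ∈-factorizationsBelow⁻ : ∀ {σs} → σs ∈ₗ factorizationsBelow c I → Admissible (sʲ c) (eʲ c) Iʲ σs × IsIdentity σs
  ∈-factorizationsBelow⁻ {σs} σs∈
    with σs∈′ , t ← ∈ₗ.∈-filter⁻ (λ σs → T? (flatBits c σs ⊑ᵇ I)) {xs = factorizations m k} σs∈
    with inj , idn ← ∈-factorizations⁻ {σs = σs} σs∈′ =
    admissible inj (λ j → ⊑⇒BlockMonotone (inj j) (sʲ c j) (eʲ c j) (Iʲ j)
      -- The slot `π⁻¹(j)` constrains the factor at position `π(π⁻¹(j))`, which is `j`.
      (subst (λ x → signedDes (sʲ c j) (eʲ c j) (lookup σs x) ⊑ Iʲ j) (inverseʳ (π c))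
        (flatBits⇒⊑ {σs} t (π c ⟨$⟩ˡ j)))) , idn

  ∈-factorizationsBelow⁺ : ∀ {σs} → Admissible (sʲ c) (eʲ c) Iʲ σs → IsIdentity σs → σs ∈ₗ factorizationsBelow c I
  ∈-factorizationsBelow⁺ {σs} ad idn = ∈ₗ.∈-filter⁺ (λ σs → T? (flatBits c σs ⊑ᵇ I))
    (∈-factorizations⁺ (bijective ad) idn)
    (⊑⇒flatBits {σs} λ i → subst (λ x → signedDes (s c x) (e c x) (lookup σs (π c ⟨$⟩ʳ i)) ⊑ unflatten I x) (inverseˡ (π c))
      (BlockMonotone⇒⊑ (bijective ad (π c ⟨$⟩ʳ i)) (sʲ c (π c ⟨$⟩ʳ i)) (eʲ c (π c ⟨$⟩ʳ i)) (Iʲ (π c ⟨$⟩ʳ i))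
        (monotone ad (π c ⟨$⟩ʳ i))))

  factorizationsBelow-unique : Unique (factorizationsBelow c I)
  factorizationsBelow-unique = Unique.filter⁺ (λ σs → T? (flatBits c σs ⊑ᵇ I))
    (Unique.filter⁺ (T? ∘ identityᵇ) (vecsOver-unique k (Sym-unique (suc m))))

module Transfer {m k} (c c′ : Configuration k) (D : Fin k → Subset m) (same-parity : xorSum (e c) ≡ xorSum (e c′)) where

  private
    πʳ πˡ ρʳ ρˡ : Fin k → Fin k
    πʳ = π c ⟨$⟩ʳ_
    πˡ = π c ⟨$⟩ˡ_
    ρʳ = π c′ ⟨$⟩ʳ_
    ρˡ = π c′ ⟨$⟩ˡ_
    K K′ : Vec (Perm (suc m)) k → Fin k → Fin (suc m) → ℕ
    K  = key (sʲ c) (D ∘ πˡ)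
    K′ = key (sʲ c′) (D ∘ ρˡ)

  -- The multisets of key tuples coincide, with coordinates matched by slot rather than by pass and
  -- with `g` renaming the objects.
  SameKeys : Vec (Perm (suc m)) k → Vec (Perm (suc m)) k → Set
  SameKeys σs τs = ∃ λ g → Inj g × (∀ i p → K σs (πʳ i) p ≡ K′ τs (ρʳ i) (g p))

  -- The keys of `σs`, permuted into the new pass order, are sorted anew. They have the right
  -- content, and for odd parity their tuples are distinct because both configurations have the same
  -- parity.
  SameKeys-total : ∀ {σs} → Admissible (sʲ c) (eʲ c) (D ∘ πˡ) σs → IsIdentity σs →
    ∃ λ τs → (Admissible (sʲ c′) (eʲ c′) (D ∘ ρˡ) τs × IsIdentity τs) × SameKeys σs τs
  SameKeys-total {σs} ad idn = reindex (fixedOrder (sʲ c′) (eʲ c′) (D ∘ ρˡ) w content distinct)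
    where
    w : Fin k → Fin (suc m) → ℕ
    -- Position `j` belongs to slot `ρˡ j` of the second configuration; the first configuration
    -- places that slot at `πʳ (ρˡ j)`.
    w j = K σs (πʳ (ρˡ j))
    content : ∀ j → Rearranges (D (ρˡ j)) (w j)
    content j = subst (λ x → Rearranges (D x) (w j)) (inverseˡ (π c)) (keys-rearrange σs ad (πʳ (ρˡ j)))
    distinct : xorSum (eʲ c′) ≡ true → ∀ {p q} → (∀ j → w j p ≡ w j q) → p ≡ q
    distinct odd {p} {q} same = identity-distinct-keys σs ad idn
      (trans (parity c) (trans same-parity (trans (sym (parity c′)) odd)))
      (λ j → subst (λ x → K σs x p ≡ K σs x q) (trans (cong πʳ (inverseˡ (π c′))) (inverseʳ (π c)))
        (same (ρʳ (πˡ j))))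
    reindex : (∃₂ λ τs g → Admissible (sʲ c′) (eʲ c′) (D ∘ ρˡ) τs × IsIdentity τs × Inj g ×
        (∀ j p → w j p ≡ K′ τs j (g p))) →
      ∃ λ τs → (Admissible (sʲ c′) (eʲ c′) (D ∘ ρˡ) τs × IsIdentity τs) × SameKeys σs τs
    reindex (τs , g , ad′ , idn′ , g-inj , keys) = τs , (ad′ , idn′) , g , g-inj ,
      λ i p → trans (cong (λ x → K σs (πʳ x) p) (sym (inverseˡ (π c′)))) (keys (ρʳ i) p)

  -- Through the common partner `τs`, the renaming `g⁻¹ ∘ g′` makes the keys of `σs′` a
  -- rearrangement of those of `σs`.
  SameKeys-injective : ∀ {σs σs′ τs} →
    Admissible (sʲ c) (eʲ c) (D ∘ πˡ) σs × IsIdentity σs →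
    Admissible (sʲ c) (eʲ c) (D ∘ πˡ) σs′ × IsIdentity σs′ →
    SameKeys σs τs → SameKeys σs′ τs → σs ≡ σs′
  SameKeys-injective {σs} {σs′} {τs} (ad , idn) (ad′ , idn′) (g , g-inj , keys) (g′ , g′-inj , keys′) =
    rearranged-keys-determine σs σs′ ad ad′ idn idn′ (f⁻¹ ∘ g′) (g′-inj ∘ f⁻¹-inj)
      (λ j p → subst (λ x → K σs′ x p ≡ K σs x (f⁻¹ (g′ p))) (inverseʳ (π c))
        (trans (keys′ (πˡ j) p) (trans (cong (K′ τs (ρʳ (πˡ j))) (sym (f∘f⁻¹ (g′ p))))
          (sym (keys (πˡ j) (f⁻¹ (g′ p)))))))
    where open Inverse g-inj

factorizationsBelow-≤ : ∀ {m k} (c c′ : Configuration k) (I : Fin (k ℕ.* m) → Bool) → xorSum (e c) ≡ xorSum (e c′) →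
  length (factorizationsBelow c I) ≤ length (factorizationsBelow c′ I)
factorizationsBelow-≤ {m} {k} c c′ I same-parity = injection⇒length≤ {R = SameKeys} (factorizationsBelow-unique c I) total
  (λ {σs} {σs′} {τs} σs∈ σs′∈ → SameKeys-injective {τs = τs} (∈-factorizationsBelow⁻ c I {σs} σs∈) (∈-factorizationsBelow⁻ c I {σs′} σs′∈))
  where
  open Transfer c c′ (unflatten I) same-parity
  total : ∀ {σs} → σs ∈ₗ factorizationsBelow c I → ∃ λ τs → τs ∈ₗ factorizationsBelow c′ I × SameKeys σs τs
  total {σs} σs∈ = map₂ (map₁ (uncurry (∈-factorizationsBelow⁺ c′ I)))
    (uncurry SameKeys-total (∈-factorizationsBelow⁻ c I {σs} σs∈))

countExact : ∀ {m k} → Configuration k → (Fin k → Subset m) → ℕ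
countExact {m} {k} c D = count (λ σs → flatBits c σs ==ᵇ λ x → uncurry (lookup ∘ D) (remQuot m x)) (factorizations m k)

countExact-parity : ∀ {m k} (c c′ : Configuration k) (D : Fin k → Subset m) → xorSum (e c) ≡ xorSum (e c′) →
  countExact c D ≡ countExact c′ D
countExact-parity {m} {k} c c′ D same-parity = möbius (flatBits c) (flatBits c′) (factorizations m k) (factorizations m k)
  -- Exchanging the two configurations supplies the reverse inequality.
  (λ I → ℕ.≤-antisym (factorizationsBelow-≤ c c′ I same-parity) (factorizationsBelow-≤ c′ c I (sym same-parity))) _

-- The four statistics and the parity of `i₂`

sign : ℕ → ℕ → ℕ → ℕ → Bool
sign i₁ i₂ i₃ i = if i <ᵇ i₁ then false else if i <ᵇ i₂ then true else if i <ᵇ i₃ then false else true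

configuration : ∀ {k} → ℕ → ℕ → ℕ → Permutation′ k → Configuration k
configuration i₁ i₂ i₃ π = record
  { s = λ i → sign i₁ i₂ i₃ (toℕ i) ; e = λ i → not (toℕ i <ᵇ i₂) ; π = π }

stat-signedDes : ∀ {m k} {i₁ i₂} i₃ → i₁ ≤ i₂ → (i : Fin k) (σ : Perm (suc m)) →
  stat i₁ i₂ i₃ i σ ≡ signedDes (sign i₁ i₂ i₃ (toℕ i)) (not (toℕ i <ᵇ i₂)) σ
stat-signedDes {i₁ = i₁} {i₂} i₃ i₁≤i₂ i σ
  with toℕ i <ᵇ i₁ | toℕ i <ᵇ i₂ | toℕ i <ᵇ i₃
     | (λ t → ℕ.<⇒<ᵇ (ℕ.<-≤-trans (ℕ.<ᵇ⇒< (toℕ i) i₁ t) i₁≤i₂))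
... | true  | true  | _     | _ = refl
-- A slot below `i₁` but not below `i₂` contradicts `i₁ ≤ i₂`.
... | true  | false | _     | b₁⇒b₂ = ⊥-elim (b₁⇒b₂ tt)
... | false | true  | _     | _ = refl
... | false | false | true  | _ = refl
... | false | false | false | _ = refl

T-ext : ∀ {a b} → (T a → T b) → (T b → T a) → a ≡ b
T-ext {false} {false} f g = refl
T-ext {true}  {true}  f g = refl
T-ext {false} {true}  f g = ⊥-elim (g tt)
T-ext {true}  {false} f g = ⊥-elim (f tt)

C≡countExact : ∀ {m k} (D : Fin k → Subset m) i₁ i₂ i₃ (π : Permutation′ k) → i₁ ≤ i₂ →
  C D i₁ i₂ i₃ π ≡ countExact (configuration i₁ i₂ i₃ π) D
C≡countExact {m} {k} D i₁ i₂ i₃ π i₁≤i₂ = trans (count-∧ identityᵇ statsᵇ (vecsOver (Sym (suc m)) k))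
  (count-cong (λ σs → T-ext (exact⁺ σs) (exact⁻ σs)) (factorizations m k))
  where
  c = configuration i₁ i₂ i₃ π
  statᵇ : Vec (Perm (suc m)) k → Fin k → Bool
  statᵇ σs i = ⌊ ≡-dec Data.Bool._≟_ (D i) (stat i₁ i₂ i₃ i (lookup σs (π ⟨$⟩ʳ i))) ⌋
  statsᵇ : Vec (Perm (suc m)) k → Bool
  statsᵇ σs = allᵇ (statᵇ σs) (List.allFin k)
  exact⁺ : ∀ σs → T (statsᵇ σs) → T (flatBits c σs ==ᵇ λ x → uncurry (lookup ∘ D) (remQuot m x))
  exact⁺ σs t = ==ᵇ⁺ λ x → let i , j = remQuot {k} m x in
    cong (λ S → lookup S j) (sym (trans (toWitness (allᵇ-allFin⁻ (statᵇ σs) t i)) (stat-signedDes i₃ i₁≤i₂ i _)))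
  exact⁻ : ∀ σs → T (flatBits c σs ==ᵇ λ x → uncurry (lookup ∘ D) (remQuot m x)) → T (statsᵇ σs)
  exact⁻ σs t = allᵇ-allFin⁺ (statᵇ σs) λ i → fromWitness (trans (D≡bits i) (sym (stat-signedDes i₃ i₁≤i₂ i _)))
    where
    D≡bits : ∀ i → D i ≡ bits c σs i
    D≡bits i = trans (sym (tabulate∘lookup (D i))) (trans (tabulate-cong bit) (tabulate∘lookup (bits c σs i)))
      where
      bit : ∀ j → lookup (D i) j ≡ lookup (bits c σs i) j
      bit j = sym (subst (λ z → uncurry (lookup ∘ bits c σs) z ≡ uncurry (lookup ∘ D) z) (Fin.remQuot-combine i j)
        (==ᵇ⁻ t (combine i j)))

odd : ℕ → Bool
odd zero    = false
odd (suc n) = not (odd n)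

odd-% : ∀ n → odd n ≡ odd (n % 2)
odd-% zero          = refl
odd-% (suc zero)    = refl
odd-% (suc (suc n)) = trans (Boolₚ.not-involutive (odd n)) (odd-% n)

-- Exactly `k − a` indices are at least `a`, and the parity of a difference is the XOR of the
-- parities.
xorSum-≥ : ∀ k a → a ≤ k → xorSum {k} (λ i → not (toℕ i <ᵇ a)) ≡ odd k xor odd a
xorSum-≥ zero    zero    _         = refl
xorSum-≥ (suc k) zero    _         = trans (cong not (xorSum-≥ k zero z≤n)) (Boolₚ.not-distribˡ-xor (odd k) false)
xorSum-≥ (suc k) (suc a) (s≤s a≤k) = trans (xorSum-≥ k a a≤k) (sym (Boolₚ.xor-annihilates-not (odd k) (odd a)))

theorem4p7 : (m k : ℕ) → 1 ≤ k → (D : Fin k → Subset m) →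
    (i₁ i₂ i₃ j₁ j₂ j₃ : ℕ) → i₁ ≤ i₂ → i₂ ≤ i₃ → i₃ ≤ k → j₁ ≤ j₂ → j₂ ≤ j₃ → j₃ ≤ k →
    (π ρ : Permutation′ k) → i₂ % 2 ≡ j₂ % 2 →
    C {m} D i₁ i₂ i₃ π ≡ C {m} D j₁ j₂ j₃ ρ
theorem4p7 m k _ D i₁ i₂ i₃ j₁ j₂ j₃ i₁≤i₂ i₂≤i₃ i₃≤k j₁≤j₂ j₂≤j₃ j₃≤k π ρ i₂≡j₂ = begin
  C D i₁ i₂ i₃ π                                ≡⟨ C≡countExact D i₁ i₂ i₃ π i₁≤i₂ ⟩
  countExact (configuration i₁ i₂ i₃ π) D       ≡⟨ countExact-parity (configuration i₁ i₂ i₃ π) (configuration j₁ j₂ j₃ ρ) D same-parity ⟩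
  countExact (configuration j₁ j₂ j₃ ρ) D       ≡⟨ C≡countExact D j₁ j₂ j₃ ρ j₁≤j₂ ⟨
  C D j₁ j₂ j₃ ρ                                ∎
  where
  open ≡-Reasoning
  same-parity : xorSum {k} (λ i → not (toℕ i <ᵇ i₂)) ≡ xorSum {k} (λ i → not (toℕ i <ᵇ j₂))
  same-parity = begin
    xorSum {k} (λ i → not (toℕ i <ᵇ i₂))   ≡⟨ xorSum-≥ k i₂ (ℕ.≤-trans i₂≤i₃ i₃≤k) ⟩
    odd k xor odd i₂                       ≡⟨ cong (odd k xor_) (odd-% i₂) ⟩
    odd k xor odd (i₂ % 2)                 ≡⟨ cong (λ r → odd k xor odd r) i₂≡j₂ ⟩
    odd k xor odd (j₂ % 2)                 ≡⟨ cong (odd k xor_) (odd-% j₂) ⟨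
    odd k xor odd j₂                       ≡⟨ xorSum-≥ k j₂ (ℕ.≤-trans j₂≤j₃ j₃≤k) ⟨
    xorSum {k} (λ i → not (toℕ i <ᵇ j₂))   ∎
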